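{- Let $\tau$ be a functional signature, let $\mathcal{C}$ be a pseudovariety of finitely generated $\tau$-algebras, let $\mathcal{V}$ be a variety of $\tau$-algebras containing $\mathcal{C}$, and let $\mathfrak{A}$ be a finitely generated $\tau$-algebra. Then the following are equivalent: (1) $\mathfrak{A}\in\mathcal{C}$; (2) the natural clone homomorphism from $\mathscr{F}^{\mathcal{V}}$ onto $\operatorname{Clo}(\mathfrak{A})$ is well-defined and $(\mathcal{U}^{\mathcal{C}},\mathcal{U}^{\mathfrak{A}})$-uniformly continuous.
   Context: Algebras are nonempty; $A$ denotes the domain of $\mathfrak{A}$. For $k\ge1$, $T_k$ is the set of abstract $\tau$-terms over $x_1,\dots,x_k$, and for $t\in T_k$, $t^{\mathfrak{A}}\colon A^k\to A$ is the induced term operation. $\operatorname{Clo}(\mathfrak{A})=\{t^{\mathfrak{A}}\mid t\in T_k,\ k\ge 1\}$ is the term clone, with $k$-ary part $\operatorname{Clo}(\mathfrak{A})_k=\{t^{\mathfrak{A}}\mid t\in T_k\}$. A class $\mathcal{C}$ of finitely generated $\tau$-algebras is a pseudovariety of finitely generated algebras if it is closed under homomorphic images (in particular isomorphic copies) and contains every algebra isomorphic to a finitely generated subalgebra of a finite product of members of $\mathcal{C}$. Finite products include the empty product (the one-element algebra). The pseudovariety of finitely generated algebras generated by $\mathfrak{A}$ consists of the finitely generated algebras that are homomorphic images of subalgebras of finite powers of $\mathfrak{A}$. For a variety $\mathcal{V}$, $\mathfrak{F}^{\mathcal{V}}_k$ (with domain $F^{\mathcal{V}}_k$) is the free algebra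 of $\mathcal{V}$ on $k$ generators $x_1,\dots,x_k$, i.e. $T_k$ modulo the identities holding in $\mathcal{V}$; $\mathscr{F}^{\mathcal{V}}$ is the term clone of the countably generated free algebra of $\mathcal{V}$, and its $k$-ary part is identified with $F^{\mathcal{V}}_k$. The natural clone homomorphism $\mathscr{F}^{\mathcal{V}}\to\operatorname{Clo}(\mathfrak{A})$ is $[t]\mapsto t^{\mathfrak{A}}$ ($t\in T_k$, $k\ge1$); it is well-defined if $[s]=[t]$ implies $s^{\mathfrak{A}}=t^{\mathfrak{A}}$ for all $k\geq 1$ and $s,t\in T_k$. A uniformity on a set $X$ is a (nonempty) filter $\mathcal{U}$ of subsets of $X\times X$, all containing the diagonal, closed under converse, and such that for each $U\in\mathcal{U}$ there is $V\in\mathcal{U}$ with $V\circ V\subseteq U$. A uniformity on a clone means a family of uniformities, one on the set of $k$-ary elements for each $k\ge1$; an arity-preserving map between clones is uniformly continuous if for every $k\ge1$ its restriction to $k$-ary elements is uniformly continuous. Definition of $\mathcal{U}^{\mathcal{C}}$ on $\mathscr{F}^{\mathcal{V}}$ for a pseudovariety $\mathcal{C}\subseteq\mathcal{V}$ of finitely generated algebras: for $k\ge1$ let $\mathcal{B}_k$ be the set of congruences $\theta$ of $\mathfrak{F}^{\mathcal{V}}_k$ with $\mathfrak{F}^{\mathcal{V}}_k/\theta\in\mathcal{C}$; then $\mathcal{U}^{\mathcal{C}}_k=\{U\subseteq F^{\mathcal{V}}_k\times F^{\mathcal{V}}_k\mid \exists\,\theta\in\mathcal{B}_k\ \ \theta\subseteq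 U\}$. Definition of $\mathcal{U}^{\mathfrak{A}}$ on $\operatorname{Clo}(\mathfrak{A})$: let $\mathcal{W}$ be the variety generated by $\mathfrak{A}$ and identify $\operatorname{Clo}(\mathfrak{A})_k$ with $F^{\mathcal{W}}_k$ via $t^{\mathfrak{A}}\leftrightarrow[t]$; then $\mathcal{U}^{\mathfrak{A}}$ is the uniformity $\mathcal{U}^{\mathcal{D}}$ on $\mathscr{F}^{\mathcal{W}}$, where $\mathcal{D}\subseteq\mathcal{W}$ is the pseudovariety of finitely generated algebras generated by $\mathfrak{A}$. -}

module Defs where

open import Level using (Level; _⊔_; Lift) renaming (suc to lsuc)
open import Data.Nat.Base using (ℕ; zero; suc; _+_; NonZero; >-nonZero⁻¹)
open import Data.Fin.Base using (Fin; zero; suc; fromℕ<; splitAt; _↑ˡ_; _↑ʳ_)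
open import Data.Fin.Properties using (splitAt-↑ˡ; splitAt-↑ʳ)
open import Data.Product.Base using (Σ; Σ-syntax; ∃; ∃-syntax; _×_; _,_; proj₁; proj₂)
open import Data.Sum.Base using (inj₁; inj₂; [_,_]′)
open import Data.Unit.Base using (⊤)
open import Function.Base using (_∘_; id)
open import Function.Bundles using (Func; Inverse)
open import Function.Definitions using (Surjective; Bijective)
open import Relation.Binary.Bundles using (Setoid)
open import Relation.Binary.Core using (Rel; _⇒_)
open import Relation.Binary.Definitions using (_Respects₂_)
open import Relation.Binary.Structures using (IsEquivalence)
open import Relation.Binary.PropositionalEquality.Core using (_≡_; refl; subst) renaming (sym to ≡-sym)
open import Relation.Unary using (Pred; _∈_)

private
  variable
    ℓ a a′ a″ b b′ b″ i p q r u : Level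

-- Sets are setoids, so that quotients are available: B / θ keeps the
-- carrier of B and takes θ as its equality.

record Signature (ℓ : Level) : Set (lsuc ℓ) where
  field
    Op    : Set ℓ
    arity : Op → ℕ

open Signature

data Term (τ : Signature ℓ) (k : ℕ) : Set ℓ where
  var : Fin k → Term τ k
  op  : (f : Op τ) → (Fin (arity τ f) → Term τ k) → Term τ k

-- The field point only says that the algebra is nonempty; homomorphisms
-- need not preserve it.

record Algebra (τ : Signature ℓ) (a b : Level) : Set (ℓ ⊔ lsuc (a ⊔ b)) where
  field
    setoid : Setoid a b

  open Setoid setoid public using (Carrier; _≈_)
    renaming (refl to ≈-refl; sym to ≈-sym; trans to ≈-trans)

  field
    ⟦_⟧    : (f : Op τ) → (Fin (arity τ f) → Carrier) → Carrier
    ⟦⟧-cong : ∀ f {x y} → (∀ j → x j ≈ y j) → ⟦ f ⟧ x ≈ ⟦ f ⟧ y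
    point  : Carrier

module _ {τ : Signature ℓ} where

  module _ (A : Algebra τ a b) where
    open Algebra A

    eval : ∀ {k} → Term τ k → (Fin k → Carrier) → Carrier
    eval (var j)  x = x j
    eval (op f t) x = ⟦ f ⟧ λ j → eval (t j) x

    _⊨_≋_ : ∀ {k} → Term τ k → Term τ k → Set (a ⊔ b)
    _⊨_≋_ {k} s t = (x : Fin k → Carrier) → eval s x ≈ eval t x

    -- The least subuniverse containing the family g.

    data Span {I : Set i} (g : I → Carrier) : Carrier → Set (ℓ ⊔ a ⊔ b ⊔ i) where
      gen  : ∀ j → Span g (g j)
      app  : ∀ f {x} → (∀ j → Span g (x j)) → Span g (⟦ f ⟧ x)
      move : ∀ {x y} → x ≈ y → Span g x → Span g y

    FinitelyGenerated : Set (ℓ ⊔ a ⊔ b)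
    FinitelyGenerated = ∃[ n ] Σ[ g ∈ (Fin n → Carrier) ] (∀ x → Span g x)

    record Subuniverse (p : Level) : Set (ℓ ⊔ a ⊔ b ⊔ lsuc p) where
      field
        pred     : Pred Carrier p
        respects : ∀ {x y} → x ≈ y → pred x → pred y
        closed   : ∀ f {x} → (∀ j → pred (x j)) → pred (⟦ f ⟧ x)
        nonempty : ∃ pred

    record Congruence (r : Level) : Set (ℓ ⊔ a ⊔ b ⊔ lsuc r) where
      field
        rel           : Rel Carrier r
        isEquivalence : IsEquivalence rel
        ≈⇒rel         : _≈_ ⇒ rel
        compatible    : ∀ f {x y} → (∀ j → rel (x j) (y j)) → rel (⟦ f ⟧ x) (⟦ f ⟧ y)

  Sub : (A : Algebra τ a b) → Subuniverse A p → Algebra τ (a ⊔ p) b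
  Sub A S = record
    { setoid  = record
      { Carrier       = Σ Carrier pred
      ; _≈_           = λ x y → proj₁ x ≈ proj₁ y
      ; isEquivalence = record { refl = ≈-refl ; sym = ≈-sym ; trans = ≈-trans }
      }
    ; ⟦_⟧     = λ f x → ⟦ f ⟧ (proj₁ ∘ x) , closed f (proj₂ ∘ x)
    ; ⟦⟧-cong = λ f → ⟦⟧-cong f
    ; point   = nonempty
    }
    where
    open Algebra A
    open Subuniverse S

  _/_ : (A : Algebra τ a b) → Congruence A r → Algebra τ a r
  A / θ = record
    { setoid  = record { isEquivalence = Congruence.isEquivalence θ }
    ; ⟦_⟧     = ⟦_⟧
    ; ⟦⟧-cong = Congruence.compatible θ
    ; point   = point
    }
    where
    open Algebra A

  ∏ : {I : Set i} → (I → Algebra τ a b) → Algebra τ (i ⊔ a) (i ⊔ b)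
  ∏ {I = I} B = record
    { setoid  = record
      { Carrier       = ∀ j → Carrier (B j)
      ; _≈_           = λ x y → ∀ j → _≈_ (B j) (x j) (y j)
      ; isEquivalence = record
        { refl  = λ j → ≈-refl (B j)
        ; sym   = λ e j → ≈-sym (B j) (e j)
        ; trans = λ d e j → ≈-trans (B j) (d j) (e j)
        }
      }
    ; ⟦_⟧     = λ f x j → ⟦_⟧ (B j) f λ m → x m j
    ; ⟦⟧-cong = λ f e j → ⟦⟧-cong (B j) f λ m → e m j
    ; point   = λ j → point (B j)
    }
    where
    open Algebra

  record Hom (A : Algebra τ a b) (B : Algebra τ a′ b′) : Set (ℓ ⊔ a ⊔ b ⊔ a′ ⊔ b′) where
    private
      module A = Algebra A
      module B = Algebra B
    field
      func : Func A.setoid B.setoid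
    open Func func public using (to) renaming (cong to to-cong)
    field
      homo : ∀ f x → to (A.⟦ f ⟧ x) B.≈ B.⟦ f ⟧ (to ∘ x)

  module _ (A : Algebra τ a b) (B : Algebra τ a′ b′) where
    private
      module A = Algebra A
      module B = Algebra B

    -- A ↠ B: B is a homomorphic image of A.

    infix 4 _↠_ _≅_

    _↠_ : Set (ℓ ⊔ a ⊔ b ⊔ a′ ⊔ b′)
    _↠_ = Σ[ h ∈ Hom A B ] Surjective A._≈_ B._≈_ (Hom.to h)

    _≅_ : Set (ℓ ⊔ a ⊔ b ⊔ a′ ⊔ b′)
    _≅_ = Σ[ h ∈ Hom A B ] Bijective A._≈_ B._≈_ (Hom.to h)

  module _ (C : Pred (Algebra τ ℓ ℓ) p) where

    record IsVariety : Set (lsuc ℓ ⊔ p) where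
      field
        image       : ∀ {A B} → A ∈ C → A ↠ B → B ∈ C
        subalgebra  : ∀ {A} → A ∈ C → (S : Subuniverse A ℓ) → Sub A S ∈ C
        product     : {I : Set ℓ} (B : I → Algebra τ ℓ ℓ) → (∀ j → B j ∈ C) → ∏ B ∈ C

    record IsPseudovariety : Set (lsuc ℓ ⊔ p) where
      field
        finitelyGenerated : ∀ {A} → A ∈ C → FinitelyGenerated A
        image             : ∀ {A B} → A ∈ C → A ↠ B → B ∈ C
        subproduct        : ∀ {n} (B : Fin n → Algebra τ ℓ ℓ) → (∀ j → B j ∈ C) →
                            (S : Subuniverse (∏ B) ℓ) → FinitelyGenerated (Sub (∏ B) S) →
                            ∀ {A} → A ≅ Sub (∏ B) S → A ∈ C

  data GeneratedVariety (A : Algebra τ ℓ ℓ) : Pred (Algebra τ ℓ ℓ) (lsuc ℓ) where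
    base       : A ∈ GeneratedVariety A
    image      : ∀ {B C} → B ∈ GeneratedVariety A → B ↠ C → C ∈ GeneratedVariety A
    subalgebra : ∀ {B} → B ∈ GeneratedVariety A → (S : Subuniverse B ℓ) →
                 Sub B S ∈ GeneratedVariety A
    product    : {I : Set ℓ} (B : I → Algebra τ ℓ ℓ) → (∀ j → B j ∈ GeneratedVariety A) →
                 ∏ B ∈ GeneratedVariety A

  generatedVariety-isVariety : ∀ A → IsVariety (GeneratedVariety A)
  generatedVariety-isVariety A = record
    { image = image ; subalgebra = subalgebra ; product = product }

  GeneratedPseudovariety : Algebra τ ℓ ℓ → Pred (Algebra τ ℓ ℓ) (lsuc ℓ)
  GeneratedPseudovariety A B =
    FinitelyGenerated B ×
    ∃[ n ] Σ[ S ∈ Subuniverse (∏ {I = Fin n} λ _ → A) ℓ ] (Sub (∏ λ _ → A) S ↠ B)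

  module _ {A : Algebra τ a b} {B : Algebra τ a′ b′} where
    private
      module A = Algebra A
      module B = Algebra B

    strictlySurjective⇒↠ : (h : Hom A B) → (∀ y → ∃[ x ] Hom.to h x B.≈ y) → A ↠ B
    strictlySurjective⇒↠ h s = h , λ y →
      proj₁ (s y) , λ e → B.≈-trans (Hom.to-cong h e) (proj₂ (s y))

    strict : ((h , _) : A ↠ B) → ∀ y → ∃[ x ] Hom.to h x B.≈ y
    strict (h , s) y = proj₁ (s y) , proj₂ (s y) A.≈-refl

    image-finitelyGenerated : A ↠ B → FinitelyGenerated A → FinitelyGenerated B
    image-finitelyGenerated h↠@(h , _) (n , g , spans) = n , Hom.to h ∘ g , λ y →
      let x , e = strict h↠ y in move e (push (spans x))
      where
      push : ∀ {x} → Span A g x → Span B (Hom.to h ∘ g) (Hom.to h x)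
      push (gen j)    = gen j
      push (app f s)  = move (B.≈-sym (Hom.homo h f _)) (app f (push ∘ s))
      push (move e s) = move (Hom.to-cong h e) (push s)

    eval-homo : (h : Hom A B) → ∀ {k} (t : Term τ k) x →
                Hom.to h (eval A t x) B.≈ eval B t (Hom.to h ∘ x)
    eval-homo h (var j)  x = B.≈-refl
    eval-homo h (op f t) x =
      B.≈-trans (Hom.homo h f _) (B.⟦⟧-cong f λ j → eval-homo h (t j) x)

    image-⊨ : A ↠ B → ∀ {k} {s t : Term τ k} → A ⊨ s ≋ t → B ⊨ s ≋ t
    image-⊨ h↠@(h , _) {s = s} {t} s≋t y =
      B.≈-trans (eval-cong s λ j → B.≈-sym (proj₂ (strict h↠ (y j))))
      (B.≈-trans (B.≈-sym (eval-homo h s x))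
      (B.≈-trans (Hom.to-cong h (s≋t x))
      (B.≈-trans (eval-homo h t x)
                 (eval-cong t λ j → proj₂ (strict h↠ (y j))))))
      where
      x : Fin _ → A.Carrier
      x j = proj₁ (strict h↠ (y j))
      eval-cong : ∀ {k} (t : Term τ k) {x y} → (∀ j → x j B.≈ y j) → eval B t x B.≈ eval B t y
      eval-cong (var j)  e = e j
      eval-cong (op f t) e = B.⟦⟧-cong f λ j → eval-cong (t j) e

  ↠-trans : {A : Algebra τ a b} {B : Algebra τ a′ b′} {C : Algebra τ a″ b″} →
            A ↠ B → B ↠ C → A ↠ C
  ↠-trans {C = C} g↠@(g , _) h↠@(h , _) = strictlySurjective⇒↠
    (record
      { func = record { to = Hom.to h ∘ Hom.to g ; cong = Hom.to-cong h ∘ Hom.to-cong g }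
      ; homo = λ f x → ≈-trans (Hom.to-cong h (Hom.homo g f x)) (Hom.homo h f _)
      })
    λ z → let y , hy≈z = strict h↠ z
              x , gx≈y = strict g↠ y
          in x , ≈-trans (Hom.to-cong h gx≈y) hy≈z
    where
    open Algebra C

  ≅-inverse : {A : Algebra τ a b} {B : Algebra τ a′ b′} → A ≅ B → B ↠ A
  ≅-inverse {A = A} {B = B} (h , inj , sur) = strictlySurjective⇒↠
    (record
      { func = record
        { to   = from
        ; cong = λ e → inj (B.≈-trans (eq _) (B.≈-trans e (B.≈-sym (eq _))))
        }
      ; homo = λ f y → inj (B.≈-trans (eq _) (B.≈-sym
                 (B.≈-trans (Hom.homo h f _) (B.⟦⟧-cong f λ j → eq (y j)))))
      })
    λ x → Hom.to h x , inj (eq _)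
    where
    module A = Algebra A
    module B = Algebra B
    from : B.Carrier → A.Carrier
    from y = proj₁ (sur y)
    eq : ∀ y → Hom.to h (from y) B.≈ y
    eq y = proj₂ (strict (h , sur) y)

  sub-⊨ : (A : Algebra τ a b) (S : Subuniverse A p) → ∀ {k} {s t : Term τ k} →
          A ⊨ s ≋ t → Sub A S ⊨ s ≋ t
  sub-⊨ A S {s = s} {t} s≋t x =
    ≈-trans (eval-homo inclusion s x)
    (≈-trans (s≋t (proj₁ ∘ x)) (≈-sym (eval-homo inclusion t x)))
    where
    open Algebra A
    inclusion : Hom (Sub A S) A
    inclusion = record { func = record { to = proj₁ ; cong = id } ; homo = λ _ _ → ≈-refl }

  ∏-⊨ : {I : Set i} (B : I → Algebra τ a b) → ∀ {k} {s t : Term τ k} →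
        (∀ j → B j ⊨ s ≋ t) → ∏ B ⊨ s ≋ t
  ∏-⊨ B {s = s} {t} s≋t x j =
    ≈-trans (eval-homo projection s x)
    (≈-trans (s≋t j λ m → x m j) (≈-sym (eval-homo projection t x)))
    where
    open Algebra (B j)
    projection : Hom (∏ B) (B j)
    projection = record { func = record { to = λ x → x j ; cong = λ e → e j }
                        ; homo = λ _ _ → ≈-refl }

  generatedVariety-⊨ : ∀ {A} {k} {s t : Term τ k} → A ⊨ s ≋ t →
                       ∀ {B} → B ∈ GeneratedVariety A → B ⊨ s ≋ t
  generatedVariety-⊨ e base                    = e
  generatedVariety-⊨ {s = s} {t} e (image B∈ h) =
    image-⊨ h {s = s} {t} (generatedVariety-⊨ {s = s} {t} e B∈)
  generatedVariety-⊨ {s = s} {t} e (subalgebra {B} B∈ S) =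
    sub-⊨ B S {s = s} {t} (generatedVariety-⊨ {s = s} {t} e B∈)
  generatedVariety-⊨ {s = s} {t} e (product B B∈) =
    ∏-⊨ B {s = s} {t} λ j → generatedVariety-⊨ {s = s} {t} e (B∈ j)

sumFin : ∀ {n} → (Fin n → ℕ) → ℕ
sumFin {zero}  m = 0
sumFin {suc n} m = m zero + sumFin (m ∘ suc)

inject : ∀ {n} (m : Fin n → ℕ) → Σ[ j ∈ Fin n ] Fin (m j) → Fin (sumFin m)
inject {suc n} m (zero  , l) = l ↑ˡ sumFin (m ∘ suc)
inject {suc n} m (suc j , l) = m zero ↑ʳ inject (m ∘ suc) (j , l)

locate : ∀ {n} (m : Fin n → ℕ) → Fin (sumFin m) → Σ[ j ∈ Fin n ] Fin (m j)
locate {suc n} m c =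
  [ (zero ,_) , (λ d → let j , l = locate (m ∘ suc) d in suc j , l) ]′ (splitAt (m zero) c)

locate-inject : ∀ {n} (m : Fin n → ℕ) c → locate m (inject m c) ≡ c
locate-inject {suc n} m (zero , l)
  rewrite splitAt-↑ˡ (m zero) l (sumFin (m ∘ suc)) = refl
locate-inject {suc n} m (suc j , l)
  rewrite splitAt-↑ʳ (m zero) (sumFin (m ∘ suc)) (inject (m ∘ suc) (j , l))
        | locate-inject (m ∘ suc) (j , l) = refl

module _ {τ : Signature ℓ} where

  generatedPseudovariety-isPseudovariety :
    (A : Algebra τ ℓ ℓ) → IsPseudovariety (GeneratedPseudovariety A)
  generatedPseudovariety-isPseudovariety A = record
    { finitelyGenerated = proj₁
    ; image             = λ { (fg , n , S , h) g →
        image-finitelyGenerated g fg , n , S , ↠-trans h g }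
    ; subproduct        = λ B B∈ S fg D≅S →
        image-finitelyGenerated (≅-inverse D≅S) fg ,
        let N , T , h = collect B B∈ S in N , T , ↠-trans h (≅-inverse D≅S)
    }
    where
    module A = Algebra A

    -- If each B j is an image of S j ≤ A ^ m j, then ∏ B is an image of a
    -- subalgebra of A ^ sumFin m.

    collect : ∀ {n} (B : Fin n → Algebra τ ℓ ℓ) → (∀ j → B j ∈ GeneratedPseudovariety A) →
              (S : Subuniverse (∏ B) ℓ) →
              ∃[ N ] Σ[ T ∈ Subuniverse (∏ {I = Fin N} λ _ → A) ℓ ]
                (Sub (∏ λ _ → A) T ↠ Sub (∏ B) S)
    collect {n} B B∈ S = sumFin m , T , strictlySurjective⇒↠ h surj
      where
      module B j = Algebra (B j)
      module S = Subuniverse S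

      m : Fin n → ℕ
      m j = proj₁ (proj₂ (B∈ j))

      R : ∀ j → Subuniverse (∏ {I = Fin (m j)} λ _ → A) ℓ
      R j = proj₁ (proj₂ (proj₂ (B∈ j)))
      module R j = Subuniverse (R j)

      g↠ : ∀ j → Sub (∏ λ _ → A) (R j) ↠ B j
      g↠ j = proj₂ (proj₂ (proj₂ (B∈ j)))
      module g j = Hom (proj₁ (g↠ j))

      block : (Fin (sumFin m) → A.Carrier) → ∀ j → Fin (m j) → A.Carrier
      block x j l = x (inject m (j , l))

      InBlocks : Pred (Fin (sumFin m) → A.Carrier) ℓ
      InBlocks x = ∀ j → R.pred j (block x j)

      apply : ∀ x → InBlocks x → ∀ j → B.Carrier j
      apply x w j = g.to j (block x j , w j)

      glue : (∀ j → Fin (m j) → A.Carrier) → Fin (sumFin m) → A.Carrier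
      glue y c = let j , l = locate m c in y j l

      block-glue : ∀ y j l → y j l A.≈ block (glue y) j l
      block-glue y j l = subst (λ c → y j l A.≈ y (proj₁ c) (proj₂ c))
                               (≡-sym (locate-inject m (j , l))) A.≈-refl

      preimage : ∀ z → S.pred z → Σ[ x ∈ _ ] Σ[ w ∈ InBlocks x ] (∀ j → B._≈_ j (apply x w j) (z j))
      preimage z _ =
        glue y ,
        (λ j → R.respects j (block-glue y j) (proj₂ (pre j))) ,
        λ j → B.≈-trans j (g.to-cong j λ l → A.≈-sym (block-glue y j l)) (proj₂ (strict (g↠ j) (z j)))
        where
        pre : ∀ j → Σ _ (R.pred j)
        pre j = proj₁ (strict (g↠ j) (z j))
        y : ∀ j → Fin (m j) → A.Carrier
        y j = proj₁ (pre j)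

      T : Subuniverse (∏ {I = Fin (sumFin m)} λ _ → A) ℓ
      T = record
        { pred     = λ x → Σ[ w ∈ InBlocks x ] S.pred (apply x w)
        ; respects = λ e (w , s) →
            (λ j → R.respects j (λ l → e (inject m (j , l))) (w j)) ,
            S.respects (λ j → g.to-cong j λ l → e (inject m (j , l))) s
        ; closed   = λ f w →
            (λ j → R.closed j f λ c → proj₁ (w c) j) ,
            S.respects (λ j → B.≈-sym j (g.homo j f _)) (S.closed f λ c → proj₂ (w c))
        ; nonempty = let z , s = S.nonempty ; x , w , e = preimage z s in
            x , w , S.respects (λ j → B.≈-sym j (e j)) s
        }

      h : Hom (Sub (∏ λ _ → A) T) (Sub (∏ B) S)
      h = record
        { func = record
          { to   = λ (x , w , s) → apply x w , s
          ; cong = λ e j → g.to-cong j λ l → e (inject m (j , l))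
          }
        ; homo = λ f x j → g.homo j f _
        }

      surj : ∀ y → ∃[ x ] Algebra._≈_ (Sub (∏ B) S) (Hom.to h x) y
      surj (z , s) = let x , w , e = preimage z s in
        (x , w , S.respects (λ j → B.≈-sym j (e j)) s) , e

record BinarySubset (X : Setoid a b) (r : Level) : Set (a ⊔ b ⊔ lsuc r) where
  open Setoid X
  field
    rel  : Rel Carrier r
    resp : rel Respects₂ _≈_

module _ {X : Setoid a b} where

  infix 4 _⊑_

  _⊑_ : BinarySubset X r → BinarySubset X r → Set (a ⊔ r)
  U ⊑ V = BinarySubset.rel U ⇒ BinarySubset.rel V

  _⊓_ : BinarySubset X r → BinarySubset X r → BinarySubset X r
  U ⊓ V = record
    { rel  = λ x y → U.rel x y × V.rel x y
    ; resp = (λ e (m , n) → proj₁ U.resp e m , proj₁ V.resp e n)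
           , (λ e (m , n) → proj₂ U.resp e m , proj₂ V.resp e n)
    }
    where
    module U = BinarySubset U
    module V = BinarySubset V

  converse : BinarySubset X r → BinarySubset X r
  converse U = record { rel = λ x y → rel y x ; resp = proj₂ resp , proj₁ resp }
    where
    open BinarySubset U

  module _ {Y : Setoid a′ b′} where

    preimage : Func X Y → BinarySubset Y r → BinarySubset X r
    preimage f U = record
      { rel  = λ x y → rel (to x) (to y)
      ; resp = (λ e → proj₁ resp (Func.cong f e)) , (λ e → proj₂ resp (Func.cong f e))
      }
      where
      open Func f using (to)
      open BinarySubset U

record Uniformity (X : Setoid a b) (r u : Level) : Set (a ⊔ b ⊔ lsuc r ⊔ lsuc u) where
  open Setoid X
  open BinarySubset using (rel)
  field
    Entourage   : Pred (BinarySubset X r) u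
    inhabited   : ∃ Entourage
    upward      : ∀ {U V} → U ∈ Entourage → U ⊑ V → V ∈ Entourage
    ∩-closed    : ∀ {U V} → U ∈ Entourage → V ∈ Entourage → (U ⊓ V) ∈ Entourage
    diagonal    : ∀ {U} → U ∈ Entourage → ∀ x → rel U x x
    symmetric   : ∀ {U} → U ∈ Entourage → converse U ∈ Entourage
    composition : ∀ {U} → U ∈ Entourage → ∃[ V ] V ∈ Entourage ×
                  (∀ {x y z} → rel V x y → rel V y z → rel U x z)

open Uniformity using (Entourage)

UniformlyContinuous : {X : Setoid a b} {Y : Setoid a′ b′} →
  Uniformity X r u → Uniformity Y r p → Func X Y → Set (a′ ⊔ b′ ⊔ lsuc r ⊔ u ⊔ p)
UniformlyContinuous 𝒰 𝒲 f = ∀ {U} → U ∈ Entourage 𝒲 → preimage f U ∈ Entourage 𝒰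

transport : {X : Setoid a b} {Y : Setoid a′ b′} →
            Inverse X Y → Uniformity X r u → Uniformity Y r u
transport {X = X} {Y = Y} φ 𝒰 = record
  { Entourage   = λ U → preimage forward U ∈ Entourage 𝒰
  ; inhabited   = let U , U∈ = 𝒰.inhabited in
      preimage backward U , 𝒰.upward U∈ (back U)
  ; upward      = λ U∈ U⊑V → 𝒰.upward U∈ U⊑V
  ; ∩-closed    = λ U∈ V∈ → 𝒰.upward (𝒰.∩-closed U∈ V∈) id
  ; diagonal    = λ {U} U∈ y → forth U (𝒰.diagonal U∈ (φ.from y))
  ; symmetric   = λ U∈ → 𝒰.upward (𝒰.symmetric U∈) id
  ; composition = λ {U} U∈ → let V , V∈ , VV⊑U = 𝒰.composition U∈ in
      preimage backward V , 𝒰.upward V∈ (back V) , λ v w → forth U (VV⊑U v w)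
  }
  where
  module φ = Inverse φ
  module 𝒰 = Uniformity 𝒰
  module X = Setoid X
  module Y = Setoid Y
  forward : Func X Y
  forward = record { to = φ.to ; cong = φ.to-cong }
  backward : Func Y X
  backward = record { to = φ.from ; cong = φ.from-cong }
  back : ∀ V → V ⊑ preimage forward (preimage backward V)
  back V v = proj₁ resp (e _) (proj₂ resp (e _) v)
    where
    open BinarySubset V
    e : ∀ x → x X.≈ φ.from (φ.to x)
    e x = X.sym (φ.inverseʳ Y.refl)
  forth : ∀ U → preimage backward (preimage forward U) ⊑ U
  forth U v = proj₁ resp (φ.inverseˡ X.refl) (proj₂ resp (φ.inverseˡ X.refl) v)
    where
    open BinarySubset U

-- A clone enters only through its sets of k-ary elements, k ≥ 1.

Graded : (a b : Level) → Set (lsuc (a ⊔ b))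
Graded a b = ∀ k → .{{NonZero k}} → Setoid a b

CloneMap : Graded a b → Graded a′ b′ → Set (a ⊔ b ⊔ a′ ⊔ b′)
CloneMap X Y = ∀ k → .{{_ : NonZero k}} → Func (X k) (Y k)

CloneUniformity : Graded a b → (r u : Level) → Set (a ⊔ b ⊔ lsuc r ⊔ lsuc u)
CloneUniformity X r u = ∀ k → .{{_ : NonZero k}} → Uniformity (X k) r u

CloneUniformlyContinuous : {X : Graded a b} {Y : Graded a′ b′} →
  CloneUniformity X r u → CloneUniformity Y r p → CloneMap X Y → Set (a′ ⊔ b′ ⊔ lsuc r ⊔ u ⊔ p)
CloneUniformlyContinuous 𝒰 𝒲 f = ∀ k → .{{_ : NonZero k}} → UniformlyContinuous (𝒰 k) (𝒲 k) (f k)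

module _ {τ : Signature ℓ} where

  module _ (V : Pred (Algebra τ ℓ ℓ) q) where

    -- Terms modulo the identities of V. As V is a large class, this equality
    -- lives above level ℓ; the quotients that can lie in a class of
    -- algebras are those by congruences of level ℓ.

    Free : ∀ k → .{{NonZero k}} → Algebra τ ℓ (lsuc ℓ ⊔ q)
    Free k = record
      { setoid  = record
        { Carrier       = Term τ k
        ; _≈_           = λ s t → ∀ {A} → A ∈ V → A ⊨ s ≋ t
        ; isEquivalence = record
          { refl  = λ {_} {A} _ _ → ≈-refl A
          ; sym   = λ e {A} A∈ x → ≈-sym A (e A∈ x)
          ; trans = λ d e {A} A∈ x → ≈-trans A (d A∈ x) (e A∈ x)
          }
        }
      ; ⟦_⟧     = op
      ; ⟦⟧-cong = λ f e {A} A∈ x → ⟦⟧-cong A f λ j → e j A∈ x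
      ; point   = var (fromℕ< (>-nonZero⁻¹ k))
      }
      where
      open Algebra

    𝓕 : Graded ℓ (lsuc ℓ ⊔ q)
    𝓕 k = Algebra.setoid (Free k)

  module _ (A : Algebra τ a b) where
    open Algebra A

    Clo : Graded (ℓ ⊔ a ⊔ b) (a ⊔ b)
    Clo k = record
      { Carrier       = Σ[ f ∈ ((Fin k → Carrier) → Carrier) ]
                        Σ[ t ∈ Term τ k ] (∀ x → f x ≈ eval A t x)
      ; _≈_           = λ f g → ∀ x → proj₁ f x ≈ proj₁ g x
      ; isEquivalence = record
        { refl  = λ _ → ≈-refl
        ; sym   = λ e x → ≈-sym (e x)
        ; trans = λ d e x → ≈-trans (d x) (e x)
        }
      }

    termOperation : ∀ {k} .{{_ : NonZero k}} → Term τ k → Setoid.Carrier (Clo k)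
    termOperation t = eval A t , t , λ _ → ≈-refl

    WellDefined : Pred (Algebra τ ℓ ℓ) q → Set (lsuc ℓ ⊔ a ⊔ b ⊔ q)
    WellDefined V = ∀ k → .{{_ : NonZero k}} → (s t : Term τ k) → Setoid._≈_ (𝓕 V k) s t →
                    Setoid._≈_ (Clo k) (termOperation s) (termOperation t)

    natural : (V : Pred (Algebra τ ℓ ℓ) q) → WellDefined V → CloneMap (𝓕 V) Clo
    natural V wd k = record { to = termOperation ; cong = λ {s} {t} → wd k s t }

  module _ (V : Pred (Algebra τ ℓ ℓ) q) {C : Pred (Algebra τ ℓ ℓ) p} (pv : IsPseudovariety C) where
    private
      module C = IsPseudovariety pv

    Base : ∀ k → .{{_ : NonZero k}} → Pred (Congruence (Free V k) ℓ) p
    Base k θ = (Free V k / θ) ∈ C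

    module _ (k : ℕ) .{{_ : NonZero k}} where
      private
        F = Free V k

      quotient-finitelyGenerated : (θ : Congruence F ℓ) → FinitelyGenerated (F / θ)
      quotient-finitelyGenerated θ = k , var , spans
        where
        spans : ∀ t → Span (F / θ) var t
        spans (var j)  = gen j
        spans (op f t) = app f (spans ∘ t)

      -- A congruence that is the kernel of a homomorphism into a finite
      -- product of members of C belongs to Base.

      kernel∈Base : ∀ {n} (B : Fin n → Algebra τ ℓ ℓ) → (∀ j → B j ∈ C) →
                    (θ : Congruence F ℓ) (h : Hom (F / θ) (∏ B)) →
                    (∀ {s t} → Algebra._≈_ (∏ B) (Hom.to h s) (Hom.to h t) →
                     Congruence.rel θ s t) →
                    θ ∈ Base k
      kernel∈Base B B∈ θ h inj =
        C.subproduct B B∈ S (image-finitelyGenerated F↠S (quotient-finitelyGenerated θ))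
          (proj₁ F↠S , inj , proj₂ F↠S)
        where
        open Algebra (∏ B)
        S : Subuniverse (∏ B) ℓ
        S = record
          { pred     = λ x → ∃[ t ] Hom.to h t ≈ x
          ; respects = λ e (t , d) → t , ≈-trans d e
          ; closed   = λ f w → op f (proj₁ ∘ w) ,
              ≈-trans (Hom.homo h f _) (⟦⟧-cong f λ j → proj₂ (w j))
          ; nonempty = _ , Algebra.point F , ≈-refl
          }
        F↠S : (F / θ) ↠ Sub (∏ B) S
        F↠S = strictlySurjective⇒↠
          (record
            { func = record { to = λ t → Hom.to h t , t , ≈-refl ; cong = Hom.to-cong h }
            ; homo = Hom.homo h
            })
          λ (_ , t , e) → t , e

      ∇ : Congruence F ℓ
      ∇ = record
        { rel           = λ _ _ → Lift ℓ ⊤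
        ; isEquivalence = _
        ; ≈⇒rel         = _
        ; compatible    = _
        }

      ∇∈Base : ∇ ∈ Base k
      ∇∈Base = kernel∈Base {0} (λ ()) (λ ()) ∇
        (record { func = record { to = λ _ () ; cong = λ _ () } ; homo = λ _ _ () }) _

      module _ (θ η : Congruence F ℓ) where
        private
          module θ = Congruence θ
          module η = Congruence η
          module θ≈ = IsEquivalence θ.isEquivalence
          module η≈ = IsEquivalence η.isEquivalence

        meet : Congruence F ℓ
        meet = record
          { rel           = λ s t → θ.rel s t × η.rel s t
          ; isEquivalence = record
            { refl  = θ≈.refl , η≈.refl
            ; sym   = λ (d , e) → θ≈.sym d , η≈.sym e
            ; trans = λ (d , e) (d′ , e′) → θ≈.trans d d′ , η≈.trans e e′
            }
          ; ≈⇒rel         = λ e → θ.≈⇒rel e , η.≈⇒rel e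
          ; compatible    = λ f e → θ.compatible f (proj₁ ∘ e) , η.compatible f (proj₂ ∘ e)
          }

        meet∈Base : θ ∈ Base k → η ∈ Base k → meet ∈ Base k
        meet∈Base θ∈ η∈ = kernel∈Base B B∈ meet
          (record
            { func = record
              { to   = λ { t zero → t ; t (suc zero) → t }
              ; cong = λ { (d , e) zero → d ; (d , e) (suc zero) → e }
              }
            ; homo = λ { f x zero → θ≈.refl ; f x (suc zero) → η≈.refl }
            })
          λ e → e zero , e (suc zero)
          where
          B : Fin 2 → Algebra τ ℓ ℓ
          B zero       = F / θ
          B (suc zero) = F / η
          B∈ : ∀ j → B j ∈ C
          B∈ zero       = θ∈
          B∈ (suc zero) = η∈

      asSubset : Congruence F ℓ → BinarySubset (𝓕 V k) ℓ
      asSubset θ = record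
        { rel  = rel
        ; resp = (λ e d → trans d (≈⇒rel e)) , (λ e d → trans (sym (≈⇒rel e)) d)
        }
        where
        open Congruence θ
        open IsEquivalence isEquivalence

    freeUniformity : CloneUniformity (𝓕 V) ℓ (lsuc ℓ ⊔ q ⊔ p)
    freeUniformity k = record
      { Entourage   = λ U → Σ[ θ ∈ Congruence (Free V k) ℓ ]
                            θ ∈ Base k × Congruence.rel θ ⇒ BinarySubset.rel U
      ; inhabited   = asSubset k (∇ k) , ∇ k , ∇∈Base k , id
      ; upward      = λ (θ , θ∈ , θ⊆U) U⊑V → θ , θ∈ , U⊑V ∘ θ⊆U
      ; ∩-closed    = λ (θ , θ∈ , θ⊆U) (η , η∈ , η⊆V) →
          meet k θ η , meet∈Base k θ η θ∈ η∈ , λ (d , e) → θ⊆U d , η⊆V e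
      ; diagonal    = λ (θ , _ , θ⊆U) t → θ⊆U (IsEquivalence.refl (Congruence.isEquivalence θ))
      ; symmetric   = λ (θ , θ∈ , θ⊆U) →
          θ , θ∈ , θ⊆U ∘ IsEquivalence.sym (Congruence.isEquivalence θ)
      ; composition = λ (θ , θ∈ , θ⊆U) → asSubset k θ , (θ , θ∈ , id) , λ d e →
          θ⊆U (IsEquivalence.trans (Congruence.isEquivalence θ) d e)
      }

  module _ (A : Algebra τ ℓ ℓ) where
    open Algebra A

    -- The identification [t] ↔ t ^ A, for the variety generated by A.

    𝓕↔Clo : ∀ k → .{{_ : NonZero k}} → Inverse (𝓕 (GeneratedVariety A) k) (Clo A k)
    𝓕↔Clo k = record
      { to        = termOperation A
      ; from      = term
      ; to-cong   = λ e → e base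
      ; from-cong = λ {f} {g} → term-cong {f} {g}
      ; inverse   = (λ {(_ , _ , f≈t)} e x → ≈-trans (e base x) (≈-sym (f≈t x)))
                  , λ {t} {f} → term-cong {f} {termOperation A t}
      }
      where
      Op[k] = Setoid.Carrier (Clo A k)
      term : Op[k] → Term τ k
      term (_ , t , _) = t
      term-cong : {f g : Op[k]} → Setoid._≈_ (Clo A k) f g →
                  Setoid._≈_ (𝓕 (GeneratedVariety A) k) (term f) (term g)
      term-cong {_ , s , f≈s} {_ , t , g≈t} e = generatedVariety-⊨ {s = s} {t} λ x →
        ≈-trans (≈-sym (f≈s x)) (≈-trans (e x) (g≈t x))

    cloneUniformity : CloneUniformity (Clo A) ℓ (lsuc ℓ)
    cloneUniformity k = transport (𝓕↔Clo k)
      (freeUniformity (GeneratedVariety A) (generatedPseudovariety-isPseudovariety A) k)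

{-# OPTIONS --safe #-}
module Submission where

-- Both directions rest on comparing quotients of free algebras with A.
--
-- Suppose that A lies in C.  Then A lies in V, so the identities of V hold
-- in A and the natural map is well defined.  A basic entourage for A is a
-- congruence of the free algebra of the variety generated by A whose quotient Q
-- lies in the pseudovariety generated by A.  The same relation on terms is a
-- congruence of the free algebra of V, with the same quotient Q.  So it is enough
-- that C contains the pseudovariety generated by A
-- (generatedPseudovariety-⊆).  There is one subtlety: a subpower of A
-- that maps onto Q need not be finitely generated, and is replaced by the
-- subalgebra generated by preimages of finitely many generators of Q.
--
-- Conversely, let x be a k-tuple generating A, with k at least 1.  Evaluation of
-- terms at x identifies A with a quotient of the free algebra, so the set of
-- pairs of k-ary term operations that agree at x is an entourage for A
-- (agreement∈Entourage).  Uniform continuity yields a congruence η of the free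
-- algebra of V, with quotient in C, such that η-related terms agree at x.
-- Evaluation at x then maps that quotient onto A, and C is closed under images.

open import Defs
open import Level using (Level; Lift; _⊔_)
open import Data.Nat.Base using (ℕ; suc; NonZero)
open import Data.Fin.Base using (Fin; zero; suc)
open import Data.Product.Base using (Σ-syntax; ∃-syntax; _×_; _,_; proj₁; proj₂)
open import Data.Unit.Base using (⊤)
open import Function.Base using (_∘_; id)
open import Function.Bundles using (_⇔_; mk⇔)
open import Relation.Unary using (Pred; _∈_; _⊆_)

private
  variable
    ℓ a b a′ b′ i p q r : Level

module _ {τ : Signature ℓ} where

  -- Generated subalgebras

  module _ (A : Algebra τ a b) {I : Set i} (g : I → Algebra.Carrier A) where
    open Algebra A

    -- The subuniverse generated by g.  It must be known to be nonempty: g may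
    -- be the empty family in a signature without constants.

    span : ∃[ x ] Span A g x → Subuniverse A (ℓ ⊔ a ⊔ b ⊔ i)
    span nonempty = record
      { pred = Span A g ; respects = move ; closed = app ; nonempty = nonempty }

    span-least : (S : Subuniverse A p) → (∀ j → Subuniverse.pred S (g j)) →
                 ∀ {x} → Span A g x → Subuniverse.pred S x
    span-least S g∈S (gen j)    = g∈S j
    span-least S g∈S (app f s)  = Subuniverse.closed S f λ j → span-least S g∈S (s j)
    span-least S g∈S (move e s) = Subuniverse.respects S e (span-least S g∈S s)

    -- The induction is on the proof of membership, which is part of the element
    -- of Sub.  Equality in Sub ignores that part, so each step of s lifts.

    span-generated : ∀ ne (x : Algebra.Carrier (Sub A (span ne))) →
                     Span (Sub A (span ne)) (λ j → g j , gen j) x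
    span-generated ne (x , s) = go s
      where
      go : ∀ {x} (s : Span A g x) → Span (Sub A (span ne)) (λ j → g j , gen j) (x , s)
      go (gen j)    = gen j
      go (app f s)  = app f λ j → go (s j)
      go (move e s) = move e (go s)

  -- If h maps each member of g′ to the corresponding member of g, then the
  -- subalgebra generated by g is covered by the one generated by g′.

  span-lift : {A : Algebra τ a b} {B : Algebra τ a′ b′} (h : Hom A B) {I : Set i}
              {g : I → Algebra.Carrier B} (g′ : I → Algebra.Carrier A) →
              (∀ j → Algebra._≈_ B (Hom.to h (g′ j)) (g j)) →
              ∀ {y} → Span B g y →
              ∃[ x ] Span A g′ x × Algebra._≈_ B (Hom.to h x) y
  span-lift h g′ e (gen j) = g′ j , gen j , e j
  span-lift {A = A} {B = B} h g′ e (app f s) =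
    let pre j = span-lift h g′ e (s j)
    in Algebra.⟦_⟧ A f (proj₁ ∘ pre) , app f (λ j → proj₁ (proj₂ (pre j))) ,
       Algebra.≈-trans B (Hom.homo h f _) (Algebra.⟦⟧-cong B f λ j → proj₂ (proj₂ (pre j)))
  span-lift {B = B} h g′ e (move d s) =
    let x , s′ , e′ = span-lift h g′ e s in x , s′ , Algebra.≈-trans B e′ d

  -- An element of the subalgebra generated by x is the value of a term at x.

  span⇒term : (A : Algebra τ a b) {k : ℕ} (x : Fin k → Algebra.Carrier A) →
              ∀ {y} → Span A x y → ∃[ t ] Algebra._≈_ A (eval A t x) y
  span⇒term A x (gen j)    = var j , Algebra.≈-refl A
  span⇒term A x (app f s)  =
    let pre j = span⇒term A x (s j)
    in op f (proj₁ ∘ pre) , Algebra.⟦⟧-cong A f (proj₂ ∘ pre)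
  span⇒term A x (move e s) =
    let t , d = span⇒term A x s in t , Algebra.≈-trans A d e

  -- The pseudovariety generated by an algebra

  self∈GeneratedPseudovariety : (A : Algebra τ ℓ ℓ) → FinitelyGenerated A →
                                A ∈ GeneratedPseudovariety A
  self∈GeneratedPseudovariety A fg = fg , 1 , full , strictlySurjective⇒↠
      (record { func = record { to = λ x → proj₁ x zero ; cong = λ e → e zero }
              ; homo = λ _ _ → ≈-refl })
      λ y → ((λ _ → y) , _) , ≈-refl
    where
    open Algebra A
    full : Subuniverse (∏ {I = Fin 1} λ _ → A) ℓ
    full = record
      { pred = λ _ → Lift ℓ ⊤ ; respects = _ ; closed = _ ; nonempty = (λ _ → point) , _ }

  generatedPseudovariety-⊆ : {C : Pred (Algebra τ ℓ ℓ) p} → IsPseudovariety C →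
                             ∀ {A} → A ∈ C → GeneratedPseudovariety A ⊆ C
  generatedPseudovariety-⊆ {C = C} pv {A} A∈ {B} ((m , g , spans) , n , S , h↠@(h , _)) =
    C.image S′∈ S′↠B
    where
    module C = IsPseudovariety pv
    module B = Algebra B
    module h = Hom h

    Aⁿ : Algebra τ ℓ ℓ
    Aⁿ = ∏ {I = Fin n} λ _ → A

    open Algebra Aⁿ

    g′ : Fin m → Algebra.Carrier (Sub Aⁿ S)
    g′ j = proj₁ (strict h↠ (g j))

    -- Preimages under h are found inside Sub Aⁿ S; pushing their spans
    -- along the inclusion places them in the span of proj₁ ∘ g′ in Aⁿ.

    inclusion : Hom (Sub Aⁿ S) Aⁿ
    inclusion = record { func = record { to = proj₁ ; cong = id } ; homo = λ _ _ → ≈-refl }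

    push : ∀ {x} → Span (Sub Aⁿ S) g′ x → Span Aⁿ (proj₁ ∘ g′) (proj₁ x)
    push (gen j)            = gen j
    push (app f s)          = app f (push ∘ s)
    push (move {x} {y} e s) = move {x = proj₁ x} {y = proj₁ y} e (push s)

    lift : ∀ y → ∃[ x ] Span (Sub Aⁿ S) g′ x × h.to x B.≈ y
    lift y = span-lift h g′ (λ j → proj₂ (strict h↠ (g j))) (spans y)

    -- B has an element, which lies in the span of its generators; its lift
    -- shows that the subalgebra is nonempty.

    nonempty : ∃[ x ] Span Aⁿ (proj₁ ∘ g′) x
    nonempty = let x , s , _ = lift B.point in proj₁ x , push s

    S′ : Subuniverse Aⁿ ℓ
    S′ = span Aⁿ (proj₁ ∘ g′) nonempty

    S′⊆S : ∀ {x} → Span Aⁿ (proj₁ ∘ g′) x → Subuniverse.pred S x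
    S′⊆S = span-least Aⁿ (proj₁ ∘ g′) S (proj₂ ∘ g′)

    S′∈ : Sub Aⁿ S′ ∈ C
    S′∈ = C.subproduct (λ _ → A) (λ _ → A∈) S′
      (m , _ , span-generated Aⁿ (proj₁ ∘ g′) nonempty)
      ( record { func = record { to = id ; cong = id } ; homo = λ _ _ → ≈-refl }
      , id , λ y → y , id )

    S′↠B : Sub Aⁿ S′ ↠ B
    S′↠B = strictlySurjective⇒↠
      (record
        { func = record { to = λ (x , s) → h.to (x , S′⊆S s) ; cong = h.to-cong }
        ; homo = λ f x → B.≈-trans (h.to-cong λ _ → Algebra.≈-refl A) (h.homo f _)
        })
      λ y → let x , s , e = lift y in
        (proj₁ x , push s) , B.≈-trans (h.to-cong λ _ → Algebra.≈-refl A) e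

  -- Evaluation of terms at a generating tuple

  module _ (A : Algebra τ ℓ ℓ) {k : ℕ} .{{_ : NonZero k}}
           (x : Fin k → Algebra.Carrier A) (spans : ∀ y → Span A x y) where
    open Algebra A

    -- A congruence of a free algebra whose related terms agree at x has a
    -- quotient mapping onto A.

    evaluation : (V : Pred (Algebra τ ℓ ℓ) q) (η : Congruence (Free V k) r) →
                 (∀ {s t} → Congruence.rel η s t → eval A s x ≈ eval A t x) →
                 (Free V k / η) ↠ A
    evaluation V η η⇒≈ = strictlySurjective⇒↠
      (record { func = record { to = λ t → eval A t x ; cong = η⇒≈ }
              ; homo = λ _ _ → ≈-refl })
      λ y → span⇒term A x (spans y)

    -- The pairs of k-ary term operations that agree at x.

    agreement : BinarySubset (Clo A k) ℓ
    agreement = record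
      { rel  = λ f g → proj₁ f x ≈ proj₁ g x
      ; resp = (λ e d → ≈-trans d (e x)) , (λ e d → ≈-trans (≈-sym (e x)) d)
      }

    agreement∈Entourage : agreement ∈ Uniformity.Entourage (cloneUniformity A k)
    agreement∈Entourage = θ ,
      IsPseudovariety.image (generatedPseudovariety-isPseudovariety A)
        (self∈GeneratedPseudovariety A (k , x , spans)) A↠F/θ ,
      id
      where
      W : Pred (Algebra τ ℓ ℓ) _
      W = GeneratedVariety A

      -- The kernel of evaluation at x.

      θ : Congruence (Free W k) ℓ
      θ = record
        { rel           = λ s t → eval A s x ≈ eval A t x
        ; isEquivalence = record { refl = ≈-refl ; sym = ≈-sym ; trans = ≈-trans }
        ; ≈⇒rel         = λ e → e base x
        ; compatible    = λ f → ⟦⟧-cong f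
        }

      A↠F/θ : A ↠ (Free W k / θ)
      A↠F/θ = let h , surjective = evaluation W θ id in ≅-inverse (h , id , surjective)

theorem4p3 : ∀ {ℓ p q : Level} (τ : Signature ℓ)
    (C : Pred (Algebra τ ℓ ℓ) p) (C-pv : IsPseudovariety C)
    (V : Pred (Algebra τ ℓ ℓ) q) → IsVariety V → C ⊆ V →
    (A : Algebra τ ℓ ℓ) → FinitelyGenerated A →
    A ∈ C ⇔
    (Σ[ wd ∈ WellDefined A V ]
    CloneUniformlyContinuous (freeUniformity V C-pv) (cloneUniformity A) (natural A V wd))
theorem4p3 {ℓ} τ C C-pv V _ C⊆V A (n , g , spans) = mk⇔ to from
  where
  WellDefinedUniformlyContinuous : Set _
  WellDefinedUniformlyContinuous = Σ[ wd ∈ WellDefined A V ]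
    CloneUniformlyContinuous (freeUniformity V C-pv) (cloneUniformity A) (natural A V wd)

  to : A ∈ C → WellDefinedUniformlyContinuous
  to A∈C = (λ _ _ _ e → e (C⊆V A∈C)) , λ k (θ , θ∈ , θ⊆U) →
    restrict k θ , generatedPseudovariety-⊆ C-pv A∈C θ∈ , θ⊆U
    where
    -- The same relation on terms, viewed over the identities of V, which are
    -- among those of the variety generated by A.

    restrict : ∀ k .{{_ : NonZero k}} →
               Congruence (Free (GeneratedVariety A) k) ℓ → Congruence (Free V k) ℓ
    restrict k θ = record
      { rel           = rel
      ; isEquivalence = isEquivalence
      ; ≈⇒rel         = λ {s} {t} e → ≈⇒rel (generatedVariety-⊨ {s = s} {t} (e (C⊆V A∈C)))
      ; compatible    = compatible
      }
      where
      open Congruence θ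

  from : WellDefinedUniformlyContinuous → A ∈ C
  from (_ , continuous) =
    let η , F/η∈C , η⊆ = continuous (suc n) {agreement A x x-spans}
          (agreement∈Entourage A x x-spans)
    in IsPseudovariety.image C-pv F/η∈C (evaluation A x x-spans V η η⊆)
    where
    -- The point of A is added to the generators only to make the arity
    -- positive, as n may be 0.

    x : Fin (suc n) → Algebra.Carrier A
    x zero    = Algebra.point A
    x (suc j) = g j

    weaken : ∀ {y} → Span A g y → Span A x y
    weaken (gen j)    = gen (suc j)
    weaken (app f s)  = app f (weaken ∘ s)
    weaken (move e s) = move e (weaken s)

    x-spans : ∀ y → Span A x y
    x-spans y = weaken (spans y)
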